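{- Let $S$ be a finite set with $n\ge1$ elements and $p:2^{S}\to\mathbb{Z}\cup\{ -\infty\}$ a set-function with $p(\emptyset)=0$ and $p(S)$ finite. Call an integer $\mu$ good if $\mu|X|\ge p(X)$ for every $X\subseteq S$, and bad otherwise; let $\mu_{\min}$ be the smallest good integer (equivalently, $\max\{\lceil p(X)/|X|\rceil:\emptyset\ne X\subseteq S\}$). Consider the following procedure. Let $\mu_0=\lceil p(S)/|S|\rceil-1$ (which is bad) and let $X_0$ be any set maximizing $p(X)-\mu_0|X|$ over $X\subseteq S$. For $j=1,2,\dots$, given $X_{j-1}$, let $\mu_j=\lceil p(X_{j-1})/|X_{j-1}|\rceil$; if $\mu_j$ is good, stop and output $\mu_j$; otherwise let $X_j$ be any set maximizing $p(X)-\mu_j|X|$ over $X\subseteq S$ (so $X_j\neq\emptyset$) and continue. Then the procedure stops, and if $h$ is the first index for which $\mu_h$ is good, then $\mu_h=\mu_{\min}$ and $h\le n$. -}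

module Defs where

open import Data.Fin.Base using (zero)
open import Data.Fin.Subset using (Subset; ∣_∣; ⊤; Nonempty)
open import Data.Fin.Subset.Properties using (∈⊤; x∈p⇒∣p-x∣<∣p∣)
open import Data.Integer.Base using (ℤ; +_; 1ℤ; _-_; _*_; _≤_)
import Data.Maybe.Base as Maybe
open import Data.Nat.Base as ℕ using (ℕ; suc; NonZero)
open import Data.Nat.Properties using (m<n⇒n≢0)
open import Data.Product.Base using (∃; _×_; _,_)
open import Data.Rational.Unnormalised.Base using (ceiling; _/_)
open import Relation.Binary.Construct.Add.Infimum.NonStrict _≤_ using (_≤₋_)
open import Relation.Binary.PropositionalEquality.Core using (_≡_)
open import Relation.Nullary.Construct.Add.Infimum using (_₋; [_])
open import Relation.Nullary.Negation.Core using (¬_)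

-- S is Fin n, and ⊥₋ plays the role of -∞ in ℤ ₋.
SetFunction : ℕ → Set
SetFunction n = Subset n → ℤ ₋

∣∣-nonZero : ∀ {n} {X : Subset n} → Nonempty X → NonZero ∣ X ∣
∣∣-nonZero (_ , x∈X) = ℕ.≢-nonZero (m<n⇒n≢0 (x∈p⇒∣p-x∣<∣p∣ x∈X))

⊤-nonempty : ∀ n → .{{NonZero n}} → Nonempty (⊤ {n})
⊤-nonempty (suc _) = zero , ∈⊤

-- ⌈ a / |X| ⌉
ceilRatio : ∀ {n} → ℤ → (X : Subset n) → Nonempty X → ℤ
ceilRatio a X X≠∅ = ceiling (_/_ a ∣ X ∣ {{∣∣-nonZero X≠∅}})

module _ {n : ℕ} (p : SetFunction n) where

  Good : ℤ → Set
  Good μ = ∀ X → p X ≤₋ [ μ * + ∣ X ∣ ]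

  Bad : ℤ → Set
  Bad μ = ¬ Good μ

  IsSmallestGood : ℤ → Set
  IsSmallestGood μ = Good μ × (∀ ν → Good ν → μ ≤ ν)

  -- μ = max { ⌈ p(X) / |X| ⌉ : ∅ ≠ X ⊆ S }; sets with p(X) = -∞ do not
  -- contribute to the maximum.
  IsMaxCeilRatio : ℤ → Set
  IsMaxCeilRatio μ =
    (∀ X (X≠∅ : Nonempty X) a → p X ≡ [ a ] → ceilRatio a X X≠∅ ≤ μ) ×
    (∃ λ X → ∃ λ (X≠∅ : Nonempty X) → ∃ λ a →
       p X ≡ [ a ] × μ ≡ ceilRatio a X X≠∅)

  -- p(X) - μ|X|, with -∞ - μ|X| = -∞
  excess : ℤ → Subset n → ℤ ₋
  excess μ X = Maybe.map (λ a → a - μ * + ∣ X ∣) (p X)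

  Maximizes : ℤ → Subset n → Set
  Maximizes μ X = ∀ Y → excess μ Y ≤₋ excess μ X

-- μ₀ = ⌈ s / |S| ⌉ - 1, where s = p(S)
initial : ∀ n → .{{NonZero n}} → ℤ → ℤ
initial n s = ceilRatio s ⊤ (⊤-nonempty n) - 1ℤ

-- An execution of the procedure, for one arbitrary choice of the maximizers.
-- Entries of the sequences after the stopping index are unconstrained.
record Execution {n : ℕ} .{{_ : NonZero n}} (p : SetFunction n) (s : ℤ) : Set where
  field
    μ : ℕ → ℤ
    X : ℕ → Subset n

  -- No test up to and including the j-th one has succeeded; the first value
  -- tested is μ₁.
  NotStopped : ℕ → Set
  NotStopped j = ∀ i → 1 ℕ.≤ i → i ℕ.≤ j → Bad p (μ i)

  field
    μ-init : μ 0 ≡ initial n s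
    X-step : ∀ j → NotStopped j → Maximizes p (μ j) (X j)
    -- Only constrains μ (suc j) when the quotient makes sense; that it always
    -- does is something to prove, not a hypothesis on executions.
    μ-step : ∀ j → NotStopped j → (X≠∅ : Nonempty (X j)) → ∀ a → p (X j) ≡ [ a ] →
             μ (suc j) ≡ ceilRatio a (X j) X≠∅

  StopsAt : ℕ → Set
  StopsAt h = 1 ℕ.≤ h × Good p (μ h) × (∀ i → 1 ℕ.≤ i → i ℕ.< h → Bad p (μ i))

{-# OPTIONS --safe #-}

-- This is the Newton–Dinkelbach method.  If μ is bad with maximizer X and
-- μ′ = ⌈ p(X) / |X| ⌉ is bad with maximizer X′, then μ < μ′, and adding
--   p(X′) - μ|X′| ≤ p(X) - μ|X|,   p(X) - μ′|X| ≤ 0 < p(X′) - μ′|X′|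
-- gives (μ′ - μ)|X′| < (μ′ - μ)|X|, so |X′| < |X|.  The sizes of the maximizers
-- are positive and strictly decreasing from at most n, hence at most n values
-- are tested.  A good μ of the form ⌈ p(X) / |X| ⌉ is the smallest good integer.
-- In particular μ_min exists because one execution can be carried out.
module Submission where

open import Defs
open import Data.Bool.Base using (true; false)
open import Data.Fin.Subset using (Subset; ⊥; ⊤; Nonempty; ∣_∣)
open import Data.Fin.Subset.Properties using (anySubset?; nonempty?; Empty-unique; ∣⊥∣≡0; ∣p∣≤n)
open import Data.Integer.Base as ℤ using (ℤ; 0ℤ; 1ℤ; +_; -_; _-_; _*_; nonNegative)
open import Data.Integer.DivMod using ([n/d]*d≤n; n<s[n/ℕd]*d; div-pos-is-/ℕ)
import Data.Integer.Properties as ℤ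
import Data.Maybe.Base as Maybe
open import Data.Nat.Base as ℕ using (ℕ; zero; suc; NonZero; _≤_; _<_; s≤s; z≤n)
import Data.Nat.Properties as ℕ
open import Data.Product.Base using (∃; _×_; _,_; proj₁; proj₂)
open import Data.Rational.Unnormalised.Base using (ceiling; _/_)
open import Data.Sum.Base using (_⊎_; inj₁; inj₂)
open import Data.Vec.Base using ([]; _∷_)
open import Function.Base using (_∘_)
open import Relation.Binary.Construct.Add.Infimum.NonStrict ℤ._≤_ using (_≤₋_; ⊥₋≤_; [_]; [≤]-injective; ≤₋-dec; ≤₋-isTotalOrder-≡)
open import Relation.Binary.Core using (Rel)
open import Relation.Binary.PropositionalEquality.Core using (_≡_; refl; sym; trans; cong; subst; subst₂)
open import Relation.Binary.Structures using (IsTotalOrder)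
open import Relation.Nullary.Construct.Add.Infimum using (⊥₋; [_])
open import Relation.Nullary.Decidable.Core using (yes; no; ¬?; decidable-stable)
open import Relation.Nullary.Negation.Core using (¬_; contradiction)

-- Rounding up integer quotients.

≤-ceiling-* : ∀ a d .{{_ : NonZero d}} → a ℤ.≤ ceiling (a / d) * + d
≤-ceiling-* a d@(suc _) = begin
  a                        ≡⟨ ℤ.neg-involutive a ⟨
  - (- a)                  ≤⟨ ℤ.neg-mono-≤ ([n/d]*d≤n (- a) (+ d)) ⟩
  - ((- a) ℤ./ + d * + d)  ≡⟨ ℤ.neg-distribˡ-* ((- a) ℤ./ + d) (+ d) ⟩
  ceiling (a / d) * + d    ∎
  where open ℤ.≤-Reasoning

-- The ceiling is the negated floor of `- a` over `d`, so the claim is that this floor is the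
-- largest integer whose multiple by `d` stays below `- a`.
ceiling-≤ : ∀ a d .{{_ : NonZero d}} ν → a ℤ.≤ ν * + d → ceiling (a / d) ℤ.≤ ν
ceiling-≤ a d@(suc _) ν a≤νd = begin
  - ((- a) ℤ./ + d)  ≡⟨ cong -_ (div-pos-is-/ℕ (- a) d) ⟩
  - ((- a) ℤ./ℕ d)   ≤⟨ ℤ.neg-mono-≤ -ν≤q ⟩
  - (- ν)            ≡⟨ ℤ.neg-involutive ν ⟩
  ν                  ∎
  where
  open ℤ.≤-Reasoning
  -ν<1+q : - ν ℤ.< ℤ.suc ((- a) ℤ./ℕ d)
  -ν<1+q = ℤ.*-cancelʳ-<-nonNeg (+ d) (begin-strict
    - ν * + d                     ≡⟨ ℤ.neg-distribˡ-* ν (+ d) ⟨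
    - (ν * + d)                   ≤⟨ ℤ.neg-mono-≤ a≤νd ⟩
    - a                           <⟨ n<s[n/ℕd]*d (- a) d ⟩
    ℤ.suc ((- a) ℤ./ℕ d) * + d    ∎)
  -ν≤q : - ν ℤ.≤ (- a) ℤ./ℕ d
  -ν≤q = subst (- ν ℤ.≤_) (ℤ.pred-suc _) (ℤ.i<j⇒i≤pred[j] -ν<1+q)

module _ {n : ℕ} (a : ℤ) (X : Subset n) (X≠∅ : Nonempty X) where

  ≤-ceilRatio-* : a ℤ.≤ ceilRatio a X X≠∅ * + ∣ X ∣
  ≤-ceilRatio-* = ≤-ceiling-* a ∣ X ∣ {{∣∣-nonZero X≠∅}}

  ceilRatio-≤ : ∀ ν → a ℤ.≤ ν * + ∣ X ∣ → ceilRatio a X X≠∅ ℤ.≤ ν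
  ceilRatio-≤ = ceiling-≤ a ∣ X ∣ {{∣∣-nonZero X≠∅}}

  <-ceilRatio : ∀ ν → ν * + ∣ X ∣ ℤ.< a → ν ℤ.< ceilRatio a X X≠∅
  <-ceilRatio ν ν∣X∣<a = ℤ.*-cancelʳ-<-nonNeg (+ ∣ X ∣) (ℤ.<-≤-trans ν∣X∣<a ≤-ceilRatio-*)

-- Maximizers over all subsets.

module _ {a ℓ} {A : Set a} {_≤′_ : Rel A ℓ} (isTotalOrder : IsTotalOrder _≡_ _≤′_) where
  open IsTotalOrder isTotalOrder renaming (refl to ≤′-refl; trans to ≤′-trans)

  -- Induction on the ground set: the best set containing the first element is compared with the
  -- best set avoiding it.
  subset-argmax : ∀ {n} (f : Subset n → A) → ∃ λ X → ∀ Y → f Y ≤′ f X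
  subset-argmax {zero}  f = [] , λ { [] → ≤′-refl }
  subset-argmax {suc n} f
    with subset-argmax (f ∘ (true ∷_)) | subset-argmax (f ∘ (false ∷_))
  ... | X , X-max | X′ , X′-max with total (f (true ∷ X)) (f (false ∷ X′))
  ...   | inj₁ X≤X′ = false ∷ X′ , λ where
    (true  ∷ Y) → ≤′-trans (X-max Y) X≤X′
    (false ∷ Y) → X′-max Y
  ...   | inj₂ X′≤X = true ∷ X , λ where
    (true  ∷ Y) → X-max Y
    (false ∷ Y) → ≤′-trans (X′-max Y) X′≤X

-- A single bad value and its maximizer.

module _ {n : ℕ} (p : SetFunction n) where

  -- A positive certificate of badness, which also records that `p X` is finite.
  Exceeds : ℤ → Subset n → Set
  Exceeds μ X = ∃ λ a → p X ≡ [ a ] × μ * + ∣ X ∣ ℤ.< a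

  CeilRatioOf : ℤ → Subset n → Set
  CeilRatioOf μ X = ∃ λ (X≠∅ : Nonempty X) → ∃ λ a → p X ≡ [ a ] × μ ≡ ceilRatio a X X≠∅

  excess-finite : ∀ μ {X a} → p X ≡ [ a ] → excess p μ X ≡ [ a - μ * + ∣ X ∣ ]
  excess-finite μ {X} = cong (Maybe.map (λ a → a - μ * + ∣ X ∣))

  maximizer : ∀ μ → ∃ (Maximizes p μ)
  maximizer μ = subset-argmax (≤₋-isTotalOrder-≡ ℤ.≤-isTotalOrder) (excess p μ)

  good-bound : ∀ μ {X a} → Good p μ → p X ≡ [ a ] → a ℤ.≤ μ * + ∣ X ∣
  good-bound μ {X} good pX≡a = [≤]-injective (subst (_≤₋ [ μ * + ∣ X ∣ ]) pX≡a (good X))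

  ≰⇒Exceeds : ∀ μ {X} → ¬ (p X ≤₋ [ μ * + ∣ X ∣ ]) → Exceeds μ X
  ≰⇒Exceeds μ {X} pX≰ with p X
  ... | ⊥₋    = contradiction (⊥₋≤ _) pX≰
  ... | [ a ] = a , refl , ℤ.≰⇒> (pX≰ ∘ [_])

  -- There are finitely many subsets, so a search decides goodness constructively and a bad `μ`
  -- yields an actual violating set.
  good-or-exceeded : ∀ μ → Good p μ ⊎ ∃ (Exceeds μ)
  good-or-exceeded μ with anySubset? (λ X → ¬? (≤₋-dec ℤ._≤?_ (p X) [ μ * + ∣ X ∣ ]))
  ... | yes (X , pX≰) = inj₂ (X , ≰⇒Exceeds μ pX≰)
  ... | no ∄X         = inj₁ λ X → decidable-stable (≤₋-dec ℤ._≤?_ _ _) (∄X ∘ (X ,_))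

  exceeds⇒bad : ∀ μ {X} → Exceeds μ X → Bad p μ
  exceeds⇒bad μ (a , pX≡a , μ∣X∣<a) good = ℤ.<⇒≱ μ∣X∣<a (good-bound μ good pX≡a)

  bad-maximizer-exceeds : ∀ μ {X} → Bad p μ → Maximizes p μ X → Exceeds μ X
  bad-maximizer-exceeds μ {X} bad max with good-or-exceeded μ
  ... | inj₁ good = contradiction good bad
  ... | inj₂ (Y , b , pY≡b , μ∣Y∣<b)
    with p X | subst (_≤₋ excess p μ X) (excess-finite μ pY≡b) (max Y)
  -- The violating `Y` has finite positive excess; the maximizer's excess is at least as large,
  -- which rules out `⊥₋` and `a ≤ μ|X|`.
  ...   | [ a ] | [ b-μ∣Y∣≤a-μ∣X∣ ] = a , refl , ℤ.≰⇒> λ a≤μ∣X∣ →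
    ℤ.<⇒≱ μ∣Y∣<b (ℤ.i-j≤0⇒i≤j (ℤ.≤-trans b-μ∣Y∣≤a-μ∣X∣ (ℤ.i≤j⇒i-j≤0 a≤μ∣X∣)))

  -- Every good `ν` satisfies the bound at `X`, hence is at least the rounded ratio of `X`, which is
  -- `μ`.
  attained-good : ∀ {μ X} → CeilRatioOf μ X → Good p μ → IsSmallestGood p μ × IsMaxCeilRatio p μ
  attained-good {μ} {X} ratio@(X≠∅ , a , pX≡a , μ≡) good =
    (good , λ ν ν-good →
      subst (ℤ._≤ ν) (sym μ≡) (ceilRatio-≤ a X X≠∅ ν (good-bound ν ν-good pX≡a))) ,
    ((λ Y Y≠∅ b pY≡b → ceilRatio-≤ b Y Y≠∅ μ (good-bound μ good pY≡b)) , X , ratio)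

  smallestGood-unique : ∀ {μ ν} → IsSmallestGood p μ → IsSmallestGood p ν → μ ≡ ν
  smallestGood-unique (μ-good , μ-least) (ν-good , ν-least) =
    ℤ.≤-antisym (μ-least _ ν-good) (ν-least _ μ-good)

  module _ (p⊥≡0 : p ⊥ ≡ [ 0ℤ ]) where

    -- At the empty set both `p` and `μ|X|` are 0, so the strict inequality fails there.
    exceeds⇒nonempty : ∀ μ {X} → Exceeds μ X → Nonempty X
    exceeds⇒nonempty μ {X} exc with nonempty? X
    ... | yes X≠∅ = X≠∅
    ... | no  X=∅ with refl ← Empty-unique X=∅ = contradiction ⊥-good-bound (exceeds-⊥ exc)
      where
      ⊥-good-bound : 0ℤ ℤ.≤ μ * + ∣ ⊥ {n} ∣
      ⊥-good-bound rewrite ∣⊥∣≡0 n | ℤ.*-zeroʳ μ = ℤ.≤-refl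
      exceeds-⊥ : Exceeds μ ⊥ → ¬ (0ℤ ℤ.≤ μ * + ∣ ⊥ {n} ∣)
      exceeds-⊥ (a , p⊥≡a , lt) with refl ← trans (sym p⊥≡0) p⊥≡a = ℤ.<⇒≱ lt

    bad-maximizer : ∀ μ {X} → Bad p μ → Maximizes p μ X →
                    Nonempty X × Exceeds μ X
    bad-maximizer μ bad max = exceeds⇒nonempty μ exc , exc
      where exc = bad-maximizer-exceeds μ bad max

  shrink : ∀ μ {μ′ X X′} → Exceeds μ X → Maximizes p μ X → CeilRatioOf μ′ X →
           Exceeds μ′ X′ → ∣ X′ ∣ < ∣ X ∣
  shrink μ {μ′} {X} {X′} (a , pX≡a , μk<a) max (X≠∅ , a′ , pX≡a′ , refl) (b , pX′≡b , μ′m<b)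
    with refl ← trans (sym pX≡a) pX≡a′ =
    ℤ.drop‿+<+ (ℤ.*-cancelˡ-<-nonNeg (μ′ - μ) {{nonNegative (ℤ.i≤j⇒0≤j-i (ℤ.<⇒≤ μ<μ′))}} (begin-strict
      (μ′ - μ) * m         ≡⟨ *-distribʳ-- m ⟩
      μ′ * m - μ * m       <⟨ ℤ.+-monoˡ-< (- (μ * m)) μ′m<b ⟩
      b - μ * m            ≤⟨ [≤]-injective (subst₂ _≤₋_ (excess-finite μ pX′≡b) (excess-finite μ pX≡a) (max X′)) ⟩
      -- Rounding up makes `p(X) - μ′|X|` nonpositive.
      a - μ * k            ≤⟨ ℤ.+-monoˡ-≤ (- (μ * k)) (≤-ceilRatio-* a X X≠∅) ⟩
      μ′ * k - μ * k       ≡⟨ *-distribʳ-- k ⟨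
      (μ′ - μ) * k         ∎))
    where
    open ℤ.≤-Reasoning
    k = + ∣ X ∣
    m = + ∣ X′ ∣
    μ<μ′ : μ ℤ.< μ′
    μ<μ′ = <-ceilRatio a X X≠∅ μ μk<a
    *-distribʳ-- : ∀ i → (μ′ - μ) * i ≡ μ′ * i - μ * i
    *-distribʳ-- i = trans (ℤ.*-distribʳ-+ i μ′ (- μ)) (cong (λ j → μ′ * i ℤ.+ j) (sym (ℤ.neg-distribˡ-* μ i)))

-- Runs of the procedure.

module _ {n : ℕ} .{{_ : NonZero n}} (p : SetFunction n) (s : ℤ) where

  -- Goodness at the full set would force the rounded ratio `c` to satisfy `c ≤ c - 1`.
  initial-bad : p ⊤ ≡ [ s ] → Bad p (initial n s)
  initial-bad p⊤≡s good = ℤ.<⇒≱ (ℤ.suc[i]≤j⇒i<j (ℤ.≤-reflexive suc[c-1]≡c))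
    (ceilRatio-≤ s ⊤ (⊤-nonempty n) (initial n s) (good-bound p (initial n s) good p⊤≡s))
    where
    c = ceilRatio s ⊤ (⊤-nonempty n)
    suc[c-1]≡c : ℤ.suc (c - 1ℤ) ≡ c
    suc[c-1]≡c = trans (cong ℤ.suc (ℤ.+-comm c (- 1ℤ))) (ℤ.suc-pred c)

  -- The value is irrelevant when X is empty or p(X) = -∞.
  nextμ : Subset n → ℤ
  nextμ X with nonempty? X | p X
  ... | yes X≠∅ | [ a ] = ceilRatio a X X≠∅
  ... | _       | _     = 0ℤ

  nextμ-ceilRatio : ∀ X (X≠∅ : Nonempty X) a → p X ≡ [ a ] → nextμ X ≡ ceilRatio a X X≠∅
  nextμ-ceilRatio X X≠∅ a pX≡a with nonempty? X | p X | pX≡a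
  ... | yes _   | _ | refl = refl
  ... | no  X=∅ | _ | _    = contradiction X≠∅ X=∅

  -- The recursion runs on without testing goodness; an execution leaves the entries after stopping
  -- free.
  execution : Execution p s
  execution = record
    { μ      = μ
    ; X      = λ j → proj₁ (maximizer p (μ j))
    ; μ-init = refl
    ; X-step = λ j _ → proj₂ (maximizer p (μ j))
    ; μ-step = λ j _ → nextμ-ceilRatio _
    }
    where
    μ : ℕ → ℤ
    μ zero    = initial n s
    μ (suc j) = nextμ (proj₁ (maximizer p (μ j)))

  module _ (p⊥≡0 : p ⊥ ≡ [ 0ℤ ]) (p⊤≡s : p ⊤ ≡ [ s ]) (E : Execution p s) where
    open Execution E

    notStopped⇒bad : ∀ j → NotStopped j → Bad p (μ j)
    -- Index 0 is never tested, so `NotStopped` says nothing about it.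
    notStopped⇒bad zero    _  = subst (Bad p) (sym μ-init) (initial-bad p⊤≡s)
    notStopped⇒bad (suc j) ns = ns (suc j) (s≤s z≤n) ℕ.≤-refl

    notStopped-suc : ∀ {j} → NotStopped j → Bad p (μ (suc j)) → NotStopped (suc j)
    notStopped-suc ns bad i 1≤i i≤1+j with ℕ.m≤n⇒m<n∨m≡n i≤1+j
    ... | inj₁ (s≤s i≤j) = ns i 1≤i i≤j
    ... | inj₂ refl      = bad

    -- Induction on the budget `r` of remaining tests: a failed test uses up one unit and shrinks
    -- the maximizer by at least one element, keeping `∣ X j ∣ ≤ r`.
    stops-from : ∀ r j → r ℕ.+ j ≡ n → ∣ X j ∣ ≤ r → NotStopped j →
                 ∃ λ h → StopsAt h × ∃ (CeilRatioOf p (μ h)) × h ≤ n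
    stops-from r j r+j≡n ∣X∣≤r ns
      with X≠∅ , exc@(a , pX≡a , _) ← bad-maximizer p p⊥≡0 (μ j) (notStopped⇒bad j ns) (X-step j ns)
      with r | good-or-exceeded p (μ (suc j))
    -- An exhausted budget would make the nonempty `X j` have size 0.
    ... | zero  | _ =
      contradiction (ℕ.n≤0⇒n≡0 ∣X∣≤r) (ℕ.≢-nonZero⁻¹ _ {{∣∣-nonZero X≠∅}})
    ... | suc r | inj₁ good =
      suc j , (s≤s z≤n , good , λ i 1≤i i<1+j → ns i 1≤i (ℕ.s≤s⁻¹ i<1+j)) ,
      (X j , X≠∅ , a , pX≡a , μ-step j ns X≠∅ a pX≡a) ,
      subst (suc j ≤_) r+j≡n (s≤s (ℕ.m≤n+m j r))
    ... | suc r | inj₂ (_ , exc⁺) =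
      stops-from r (suc j) (trans (ℕ.+-suc r j) r+j≡n)
        (ℕ.s≤s⁻¹ (ℕ.≤-trans ∣X⁺∣<∣X∣ ∣X∣≤r)) ns⁺
      where
      ns⁺ = notStopped-suc ns (exceeds⇒bad p (μ (suc j)) exc⁺)
      ∣X⁺∣<∣X∣ : ∣ X (suc j) ∣ < ∣ X j ∣
      ∣X⁺∣<∣X∣ = shrink p (μ j) exc (X-step j ns) (X≠∅ , a , pX≡a , μ-step j ns X≠∅ a pX≡a)
        (bad-maximizer-exceeds p (μ (suc j)) (notStopped⇒bad (suc j) ns⁺) (X-step (suc j) ns⁺))

    stops : ∃ λ h → StopsAt h × (IsSmallestGood p (μ h) × IsMaxCeilRatio p (μ h)) × h ≤ n
    stops
      with h , stopsAt@(_ , good , _) , (_ , ratio) , h≤n ←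
        -- The full budget is `n`; `NotStopped 0` is vacuous, since no `i` has `1 ≤ i ≤ 0`.
        stops-from n 0 (ℕ.+-identityʳ n) (∣p∣≤n (X 0)) (λ { _ (s≤s _) () })
      = h , stopsAt , attained-good p ratio good , h≤n

theorem2p11 : (n : ℕ) .{{_ : NonZero n}} (p : SetFunction n) (s : ℤ) →
    p ⊥ ≡ [ 0ℤ ] →
    p ⊤ ≡ [ s ] →
    Bad p (initial n s) ×
    (∀ μ → Bad p μ →
    (∃ λ (X : Subset n) → Maximizes p μ X) ×
    (∀ X → Maximizes p μ X → Nonempty X × (∃ λ (a : ℤ) → p X ≡ [ a ]))) ×
    (∃ λ (μmin : ℤ) →
    IsSmallestGood p μmin ×
    IsMaxCeilRatio p μmin ×
    ((E : Execution p s) →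
    ∃ λ (h : ℕ) → Execution.StopsAt E h × Execution.μ E h ≡ μmin × h ≤ n))
theorem2p11 n p s p⊥≡0 p⊤≡s
  with _ , _ , (smallest , isMax) , _ ← stops p s p⊥≡0 p⊤≡s (execution p s) =
  initial-bad p s p⊤≡s ,
  (λ μ bad → maximizer p μ , λ X max →
    let X≠∅ , a , pX≡a , _ = bad-maximizer p p⊥≡0 μ bad max in X≠∅ , a , pX≡a) ,
  -- `μmin` comes from one fixed run; any other run ends at a smallest good integer too, hence at
  -- the same value.
  (_ , smallest , isMax , λ E →
    let h , stopsAt , (smallest′ , _) , h≤n = stops p s p⊥≡0 p⊤≡s E
    in h , stopsAt , smallestGood-unique p smallest′ smallest , h≤n)
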